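{- Consider the recurrent relation $\mathfrak{y}_{n+1}=\mathfrak{a}_{n}\mathfrak{y}_{n}-\mathfrak{y}_{n-1}$ ($n\ge 1$) with unknown sequence $(\mathfrak{y}_k)_{k\ge 0}\subset M_l(\mathbb{C})$, where the sequence $(\mathfrak{a}_{n})_{n\ge 1}\subset M_l(\mathbb{C})$ is $N$-periodic. Suppose that the matrix $\mathfrak{m}\in M_l(\mathbb{C})$ satisfies $\mathfrak{m}\mathfrak{a}_{k}=\mathfrak{a}_k\mathfrak{m}$ for $k=1,2,\ldots,N$. Then $\mathfrak{m}$ is the monodromy matrix of every solution (that is, every solution $(\mathfrak{y}_{k})_{k\ge 0}$ satisfies $\mathfrak{y}_{k+N}=\mathfrak{m}\mathfrak{y}_{k}$ for all $k\ge 0$) if and only if $$\mathfrak{p}_{N-1}(\mathfrak{a}_{1},\ldots,\mathfrak{a}_{N-1})=O,\qquad \mathfrak{p}_{N-2}(\mathfrak{a}_{2},\ldots,\mathfrak{a}_{N-1})=-\mathfrak{m},$$ and $$\mathfrak{p}_{N}(\mathfrak{a}_{1},\ldots,\mathfrak{a}_{N})=\mathfrak{m},\qquad \mathfrak{p}_{N-1}(\mathfrak{a}_{2},\ldots,\mathfrak{a}_{N})=O.$$ Moreover, in this case $$M(\mathfrak{a}_{1},\ldots,\mathfrak{a}_{N})=\begin{pmatrix} \mathfrak{m} & O\\ O & \mathfrak{m}\end{pmatrix}.$$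
   Context: $I$, $O$ are the $l\times l$ identity and zero matrices. The left matrix signed Chebyshev polynomials are defined, for a finite sequence of $l\times l$ matrices $(\mathfrak{a}_1,\ldots,\mathfrak{a}_m)$, by $\mathfrak{p}_{ -1}=O$, $\mathfrak{p}_{0}=I$ and $$\mathfrak{p}_{m}(\mathfrak{a}_{1},\ldots,\mathfrak{a}_{m})=\mathfrak{a}_{m}\mathfrak{p}_{m-1}(\mathfrak{a}_{1},\ldots,\mathfrak{a}_{m-1})-\mathfrak{p}_{m-2}(\mathfrak{a}_{1},\ldots,\mathfrak{a}_{m-2}),\quad m\ge 1;$$ $\mathfrak{p}_{r}(\mathfrak{a}_{2},\ldots,\mathfrak{a}_{r+1})$ denotes the same polynomial evaluated at the shifted sequence. Also $$M(\mathfrak{a}_{1},\ldots,\mathfrak{a}_{N})=\begin{pmatrix} \mathfrak{a}_{N} & -I\\ I & O\end{pmatrix}\cdots\begin{pmatrix} \mathfrak{a}_{1} & -I\\ I & O\end{pmatrix}.$$ -}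

module Defs where

open import Algebra.Bundles using (CommutativeRing)
open import Algebra.Structures using (IsCommutativeRing)
open import Data.Fin.Properties using (_≟_)
open import Data.Integer.Base as ℤ using (ℤ; +_; -[1+_])
open import Data.Nat.Base as ℕ using (ℕ; zero; suc; _⊔_)
import Data.Nat.Properties as ℕ
open import Data.Product using (∃; _×_; _,_; proj₁; proj₂)
open import Data.Rational.Base as ℚᵇ using (ℚ; 0ℚ; 1ℚ; ½; ∣_∣; Positive)
import Data.Rational.Properties as ℚₚ
open import Data.Vec.Functional using (Vector; _++_; zipWith)
open import Level as Level using (0ℓ)
open import Relation.Binary.PropositionalEquality
  using (_≡_; refl; sym; trans; cong; subst)
open import Relation.Binary.Structures using (IsEquivalence)
open import Relation.Nullary.Decidable using (does; dec⇒maybe)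
open import Data.Bool.Base using (if_then_else_)
open import Tactic.RingSolver using (solve-∀)
open import Tactic.RingSolver.Core.AlmostCommutativeRing
  using (AlmostCommutativeRing; fromCommutativeRing)

-- ℝ is the setoid of Cauchy sequences of rationals modulo null sequences.
module Real where

  open ℚᵇ using (_+_; _*_; _-_; -_; _<_; _≤_)

  ℚring : AlmostCommutativeRing 0ℓ 0ℓ
  ℚring = fromCommutativeRing ℚₚ.+-*-commutativeRing (λ q → dec⇒maybe (0ℚ ℚₚ.≟ q))

  Cauchy : (ℕ → ℚ) → Set
  Cauchy f = ∀ ε → 0ℚ < ε → ∃ λ K → ∀ m n → K ℕ.≤ m → K ℕ.≤ n → ∣ f m - f n ∣ < ε

  record ℝ : Set where
    constructor mkℝ
    field
      seq    : ℕ → ℚ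
      cauchy : Cauchy seq

  open ℝ public

  infix 4 _≈_
  record _≈_ (x y : ℝ) : Set where
    constructor mk≈
    field
      null : ∀ ε → 0ℚ < ε → ∃ λ K → ∀ n → K ℕ.≤ n → ∣ seq x n - seq y n ∣ < ε

  open _≈_ public

  private
    ½-pos : ∀ ε → 0ℚ < ε → 0ℚ < ½ * ε
    ½-pos ε 0<ε = ℚₚ.positive⁻¹ (½ * ε) {{ℚₚ.pos*pos⇒pos ½ ε {{ℚᵇ.positive 0<ε}}}}

    ½+½ : ∀ ε → ½ * ε + ½ * ε ≡ ε
    ½+½ ε = trans (sym (ℚₚ.*-distribʳ-+ ε ½ ½)) (ℚₚ.*-identityˡ ε)

    ∣+∣< : ∀ ε p q → ∣ p ∣ < ½ * ε → ∣ q ∣ < ½ * ε → ∣ p + q ∣ < ε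
    ∣+∣< ε p q p< q< = subst (∣ p + q ∣ <_) (½+½ ε)
      (ℚₚ.≤-<-trans (ℚₚ.∣p+q∣≤∣p∣+∣q∣ p q) (ℚₚ.+-mono-< p< q<))

    ∣-∣-comm : ∀ p q → ∣ p - q ∣ ≡ ∣ q - p ∣
    ∣-∣-comm p q = trans (sym (ℚₚ.∣-p∣≡∣p∣ (p - q))) (cong ∣_∣ (lem p q))
      where
      lem : ∀ p q → - (p - q) ≡ q - p
      lem = solve-∀ ℚring

    add-close : ∀ ε x x′ y y′ → ∣ x - x′ ∣ < ½ * ε → ∣ y - y′ ∣ < ½ * ε →
                ∣ (x + y) - (x′ + y′) ∣ < ε
    add-close ε x x′ y y′ p q =
      subst (λ z → ∣ z ∣ < ε) (lem x x′ y y′) (∣+∣< ε (x - x′) (y - y′) p q)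
      where
      lem : ∀ x x′ y y′ → (x - x′) + (y - y′) ≡ (x + y) - (x′ + y′)
      lem = solve-∀ ℚring

    trans-close : ∀ ε x y z → ∣ x - y ∣ < ½ * ε → ∣ y - z ∣ < ½ * ε → ∣ x - z ∣ < ε
    trans-close ε x y z p q =
      subst (λ w → ∣ w ∣ < ε) (lem x y z) (∣+∣< ε (x - y) (y - z) p q)
      where
      lem : ∀ x y z → (x - y) + (y - z) ≡ x - z
      lem = solve-∀ ℚring

    neg-close : ∀ ε x y → ∣ x - y ∣ < ε → ∣ - x - - y ∣ < ε
    neg-close ε x y = subst (_< ε) (trans (∣-∣-comm x y) (cong ∣_∣ (lem x y)))
      where
      lem : ∀ x y → y - x ≡ - x - - y
      lem = solve-∀ ℚring

    scale : ∀ B .{{_ : Positive B}} → ℚ → ℚ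
    scale B ε = (ℚᵇ.1/ B) {{ℚₚ.pos⇒nonZero B}} * (½ * ε)

    scale-pos : ∀ B .{{_ : Positive B}} ε → 0ℚ < ε → 0ℚ < scale B ε
    scale-pos B ε 0<ε = ℚₚ.positive⁻¹ (scale B ε)
      {{ℚₚ.pos*pos⇒pos ((ℚᵇ.1/ B) {{ℚₚ.pos⇒nonZero B}}) {{ℚₚ.1/pos⇒pos B}}
                      (½ * ε) {{ℚᵇ.positive (½-pos ε 0<ε)}}}}

    *-small : ∀ B .{{_ : Positive B}} ε b d → ∣ b ∣ < B → ∣ d ∣ < scale B ε →
              ∣ b * d ∣ < ½ * ε
    *-small B ε b d b< d< = begin-strict
      ∣ b * d ∣                      ≡⟨ ℚₚ.∣p*q∣≡∣p∣*∣q∣ b d ⟩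
      ∣ b ∣ * ∣ d ∣                  ≤⟨ ℚₚ.*-monoʳ-≤-nonNeg ∣ d ∣ {{ℚₚ.∣-∣-nonNeg d}} (ℚₚ.<⇒≤ b<) ⟩
      B * ∣ d ∣                      <⟨ ℚₚ.*-monoʳ-<-pos B d< ⟩
      B * (B⁻¹ * (½ * ε))            ≡⟨ sym (ℚₚ.*-assoc B B⁻¹ (½ * ε)) ⟩
      B * B⁻¹ * (½ * ε)              ≡⟨ cong (_* (½ * ε)) (ℚₚ.*-inverseʳ B {{ℚₚ.pos⇒nonZero B}}) ⟩
      1ℚ * (½ * ε)                   ≡⟨ ℚₚ.*-identityˡ (½ * ε) ⟩
      ½ * ε                          ∎
      where
      open ℚₚ.≤-Reasoning
      B⁻¹ : ℚ
      B⁻¹ = (ℚᵇ.1/ B) {{ℚₚ.pos⇒nonZero B}}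

    mul-close : ∀ B C .{{_ : Positive B}} .{{_ : Positive C}} ε x x′ y y′ →
                ∣ x ∣ < B → ∣ y′ ∣ < C →
                ∣ x - x′ ∣ < scale C ε → ∣ y - y′ ∣ < scale B ε →
                ∣ x * y - x′ * y′ ∣ < ε
    mul-close B C ε x x′ y y′ x< y′< dx dy =
      subst (λ z → ∣ z ∣ < ε) (lem x x′ y y′)
        (∣+∣< ε (x * (y - y′)) (y′ * (x - x′))
          (*-small B ε x (y - y′) x< dy) (*-small C ε y′ (x - x′) y′< dx))
      where
      lem : ∀ x x′ y y′ → x * (y - y′) + y′ * (x - x′) ≡ x * y - x′ * y′
      lem = solve-∀ ℚring

    0<1 : 0ℚ < 1ℚ
    0<1 = ℚₚ.positive⁻¹ 1ℚ

    bound : ℝ → ℚ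
    bound x = 1ℚ + ∣ seq x (proj₁ (cauchy x 1ℚ 0<1)) ∣

    boundPos : ∀ x → Positive (bound x)
    boundPos x = ℚₚ.pos+nonNeg⇒pos 1ℚ ∣ f ∣ {{ℚₚ.∣-∣-nonNeg f}}
      where
      f : ℚ
      f = seq x (proj₁ (cauchy x 1ℚ 0<1))

    bounded : ∀ x n → proj₁ (cauchy x 1ℚ 0<1) ℕ.≤ n → ∣ seq x n ∣ < bound x
    bounded x n K≤n = begin-strict
      ∣ seq x n ∣                        ≡⟨ cong ∣_∣ (lem (seq x n) (seq x K)) ⟩
      ∣ (seq x n - seq x K) + seq x K ∣  ≤⟨ ℚₚ.∣p+q∣≤∣p∣+∣q∣ (seq x n - seq x K) (seq x K) ⟩
      ∣ seq x n - seq x K ∣ + ∣ seq x K ∣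
        <⟨ ℚₚ.+-monoˡ-< ∣ seq x K ∣ (proj₂ (cauchy x 1ℚ 0<1) n K K≤n ℕ.≤-refl) ⟩
      bound x                            ∎
      where
      open ℚₚ.≤-Reasoning
      K : ℕ
      K = proj₁ (cauchy x 1ℚ 0<1)
      lem : ∀ p q → p ≡ (p - q) + q
      lem = solve-∀ ℚring

    ⊔ˡ : ∀ {j k n} → j ⊔ k ℕ.≤ n → j ℕ.≤ n
    ⊔ˡ {j} {k} = ℕ.m⊔n≤o⇒m≤o j k

    ⊔ʳ : ∀ {j k n} → j ⊔ k ℕ.≤ n → k ℕ.≤ n
    ⊔ʳ {j} {k} = ℕ.m⊔n≤o⇒n≤o j k

    ∣p-p∣≡0 : ∀ p → ∣ p - p ∣ ≡ 0ℚ
    ∣p-p∣≡0 p = cong ∣_∣ (ℚₚ.+-inverseʳ p)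

  pointwise : ∀ {x y} → (∀ n → seq x n ≡ seq y n) → x ≈ y
  pointwise {x} {y} eq .null ε 0<ε = 0 , λ n _ →
    subst (_< ε) (sym (trans (cong (λ z → ∣ seq x n - z ∣) (sym (eq n))) (∣p-p∣≡0 (seq x n)))) 0<ε

  fromℚ : ℚ → ℝ
  fromℚ q .seq _ = q
  fromℚ q .cauchy ε 0<ε = 0 , λ _ _ _ _ → subst (_< ε) (sym (∣p-p∣≡0 q)) 0<ε

  -- These proofs are abstract only to keep them from being unfolded.
  abstract
    +-cauchy : ∀ x y → Cauchy (λ n → seq x n + seq y n)
    +-cauchy x y ε 0<ε =
      let (j , p) = cauchy x (½ * ε) (½-pos ε 0<ε)
          (k , q) = cauchy y (½ * ε) (½-pos ε 0<ε)
      in j ⊔ k , λ m n ≤m ≤n →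
           add-close ε (seq x m) (seq x n) (seq y m) (seq y n)
             (p m n (⊔ˡ ≤m) (⊔ˡ ≤n)) (q m n (⊔ʳ {j} ≤m) (⊔ʳ {j} ≤n))

    neg-cauchy : ∀ x → Cauchy (λ n → - seq x n)
    neg-cauchy x ε 0<ε =
      let (k , p) = cauchy x ε 0<ε
      in k , λ m n ≤m ≤n → neg-close ε (seq x m) (seq x n) (p m n ≤m ≤n)

    *-cauchy : ∀ x y → Cauchy (λ n → seq x n * seq y n)
    *-cauchy x y ε 0<ε =
      let (j , p) = cauchy x (scale (bound y) {{boundPos y}} ε) (scale-pos (bound y) {{boundPos y}} ε 0<ε)
          (k , q) = cauchy y (scale (bound x) {{boundPos x}} ε) (scale-pos (bound x) {{boundPos x}} ε 0<ε)
          bx = proj₁ (cauchy x 1ℚ 0<1)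
          by = proj₁ (cauchy y 1ℚ 0<1)
      in (j ⊔ k) ⊔ (bx ⊔ by) , λ m n ≤m ≤n →
           mul-close (bound x) (bound y) {{boundPos x}} {{boundPos y}} ε
             (seq x m) (seq x n) (seq y m) (seq y n)
             (bounded x m (⊔ˡ (⊔ʳ {j ⊔ k} ≤m)))
             (bounded y n (⊔ʳ {bx} (⊔ʳ {j ⊔ k} ≤n)))
             (p m n (⊔ˡ (⊔ˡ {j ⊔ k} ≤m)) (⊔ˡ (⊔ˡ {j ⊔ k} ≤n)))
             (q m n (⊔ʳ {j} (⊔ˡ {j ⊔ k} ≤m)) (⊔ʳ {j} (⊔ˡ {j ⊔ k} ≤n)))

  infixl 6 _+ᴿ_
  infixl 7 _*ᴿ_
  infix 8 -ᴿ_

  _+ᴿ_ : ℝ → ℝ → ℝ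
  (x +ᴿ y) .seq n  = seq x n + seq y n
  (x +ᴿ y) .cauchy = +-cauchy x y

  -ᴿ_ : ℝ → ℝ
  (-ᴿ x) .seq n  = - seq x n
  (-ᴿ x) .cauchy = neg-cauchy x

  _*ᴿ_ : ℝ → ℝ → ℝ
  (x *ᴿ y) .seq n  = seq x n * seq y n
  (x *ᴿ y) .cauchy = *-cauchy x y

  ≈-isEquivalence : IsEquivalence _≈_
  ≈-isEquivalence = record
    { refl  = pointwise (λ _ → refl)
    ; sym   = λ {x} {y} x≈y → mk≈ λ ε 0<ε → proj₁ (null x≈y ε 0<ε) , λ n ≤n →
                subst (_< ε) (∣-∣-comm (seq x n) (seq y n)) (proj₂ (null x≈y ε 0<ε) n ≤n)
    ; trans = λ {x} {y} {z} x≈y y≈z → mk≈ λ ε 0<ε →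
                let (j , p) = null x≈y (½ * ε) (½-pos ε 0<ε)
                    (k , q) = null y≈z (½ * ε) (½-pos ε 0<ε)
                in j ⊔ k , λ n ≤n → trans-close ε (seq x n) (seq y n) (seq z n)
                     (p n (⊔ˡ ≤n)) (q n (⊔ʳ {j} ≤n))
    }

  +ᴿ-cong : ∀ {x x′ y y′} → x ≈ x′ → y ≈ y′ → x +ᴿ y ≈ x′ +ᴿ y′
  +ᴿ-cong {x} {x′} {y} {y′} x≈ y≈ .null ε 0<ε =
    let (j , p) = null x≈ (½ * ε) (½-pos ε 0<ε)
        (k , q) = null y≈ (½ * ε) (½-pos ε 0<ε)
    in j ⊔ k , λ n ≤n → add-close ε (seq x n) (seq x′ n) (seq y n) (seq y′ n)
         (p n (⊔ˡ ≤n)) (q n (⊔ʳ {j} ≤n))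

  -ᴿ-cong : ∀ {x y} → x ≈ y → -ᴿ x ≈ -ᴿ y
  -ᴿ-cong {x} {y} x≈y .null ε 0<ε =
    let (k , p) = null x≈y ε 0<ε
    in k , λ n ≤n → neg-close ε (seq x n) (seq y n) (p n ≤n)

  *ᴿ-cong : ∀ {x x′ y y′} → x ≈ x′ → y ≈ y′ → x *ᴿ y ≈ x′ *ᴿ y′
  *ᴿ-cong {x} {x′} {y} {y′} x≈ y≈ .null ε 0<ε =
    let (j , p) = null x≈ (scale (bound y′) {{boundPos y′}} ε) (scale-pos (bound y′) {{boundPos y′}} ε 0<ε)
        (k , q) = null y≈ (scale (bound x) {{boundPos x}} ε) (scale-pos (bound x) {{boundPos x}} ε 0<ε)
        bx = proj₁ (cauchy x 1ℚ 0<1)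
        by = proj₁ (cauchy y′ 1ℚ 0<1)
    in (j ⊔ k) ⊔ (bx ⊔ by) , λ n ≤n →
         mul-close (bound x) (bound y′) {{boundPos x}} {{boundPos y′}} ε
           (seq x n) (seq x′ n) (seq y n) (seq y′ n)
           (bounded x n (⊔ˡ (⊔ʳ {j ⊔ k} ≤n)))
           (bounded y′ n (⊔ʳ {bx} (⊔ʳ {j ⊔ k} ≤n)))
           (p n (⊔ˡ (⊔ˡ {j ⊔ k} ≤n)))
           (q n (⊔ʳ {j} (⊔ˡ {j ⊔ k} ≤n)))

  ℝ-isCommutativeRing : IsCommutativeRing _≈_ _+ᴿ_ _*ᴿ_ -ᴿ_ (fromℚ 0ℚ) (fromℚ 1ℚ)
  ℝ-isCommutativeRing = record
    { isRing = record
      { +-isAbelianGroup = record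
        { isGroup = record
          { isMonoid = record
            { isSemigroup = record
              { isMagma = record { isEquivalence = ≈-isEquivalence ; ∙-cong = +ᴿ-cong }
              ; assoc   = λ x y z → pointwise (λ n → ℚₚ.+-assoc (seq x n) (seq y n) (seq z n))
              }
            ; identity = (λ x → pointwise (λ n → ℚₚ.+-identityˡ (seq x n)))
                       , (λ x → pointwise (λ n → ℚₚ.+-identityʳ (seq x n)))
            }
          ; inverse = (λ x → pointwise (λ n → ℚₚ.+-inverseˡ (seq x n)))
                    , (λ x → pointwise (λ n → ℚₚ.+-inverseʳ (seq x n)))
          ; ⁻¹-cong = -ᴿ-cong
          }
        ; comm = λ x y → pointwise (λ n → ℚₚ.+-comm (seq x n) (seq y n))
        }
      ; *-cong     = *ᴿ-cong
      ; *-assoc    = λ x y z → pointwise (λ n → ℚₚ.*-assoc (seq x n) (seq y n) (seq z n))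
      ; *-identity = (λ x → pointwise (λ n → ℚₚ.*-identityˡ (seq x n)))
                   , (λ x → pointwise (λ n → ℚₚ.*-identityʳ (seq x n)))
      ; distrib    = (λ x y z → pointwise (λ n → ℚₚ.*-distribˡ-+ (seq x n) (seq y n) (seq z n)))
                   , (λ x y z → pointwise (λ n → ℚₚ.*-distribʳ-+ (seq x n) (seq y n) (seq z n)))
      }
    ; *-comm = λ x y → pointwise (λ n → ℚₚ.*-comm (seq x n) (seq y n))
    }

  ℝ-commutativeRing : CommutativeRing 0ℓ 0ℓ
  ℝ-commutativeRing = record { isCommutativeRing = ℝ-isCommutativeRing }

open Real public using (ℝ; ℝ-commutativeRing)

module Complex where

  open Real using (seq; pointwise)

  private module Laws where
    open ℚᵇ using (_+_; _*_; _-_)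

    assoc-re : ∀ a b c d e f → (a * c - b * d) * e - (a * d + b * c) * f ≡
               a * (c * e - d * f) - b * (c * f + d * e)
    assoc-re = solve-∀ Real.ℚring
    assoc-im : ∀ a b c d e f → (a * c - b * d) * f + (a * d + b * c) * e ≡
               a * (c * f + d * e) + b * (c * e - d * f)
    assoc-im = solve-∀ Real.ℚring
    idˡ-re : ∀ a b → 1ℚ * a - 0ℚ * b ≡ a
    idˡ-re = solve-∀ Real.ℚring
    idˡ-im : ∀ a b → 1ℚ * b + 0ℚ * a ≡ b
    idˡ-im = solve-∀ Real.ℚring
    idʳ-re : ∀ a b → a * 1ℚ - b * 0ℚ ≡ a
    idʳ-re = solve-∀ Real.ℚring
    idʳ-im : ∀ a b → a * 0ℚ + b * 1ℚ ≡ b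
    idʳ-im = solve-∀ Real.ℚring
    distˡ-re : ∀ a b c d e f → a * (c + e) - b * (d + f) ≡ (a * c - b * d) + (a * e - b * f)
    distˡ-re = solve-∀ Real.ℚring
    distˡ-im : ∀ a b c d e f → a * (d + f) + b * (c + e) ≡ (a * d + b * c) + (a * f + b * e)
    distˡ-im = solve-∀ Real.ℚring
    distʳ-re : ∀ a b c d e f → (c + e) * a - (d + f) * b ≡ (c * a - d * b) + (e * a - f * b)
    distʳ-re = solve-∀ Real.ℚring
    distʳ-im : ∀ a b c d e f → (c + e) * b + (d + f) * a ≡ (c * b + d * a) + (e * b + f * a)
    distʳ-im = solve-∀ Real.ℚring
    comm-re : ∀ a b c d → a * c - b * d ≡ c * a - d * b
    comm-re = solve-∀ Real.ℚring
    comm-im : ∀ a b c d → a * d + b * c ≡ c * b + d * a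
    comm-im = solve-∀ Real.ℚring

  open CommutativeRing ℝ-commutativeRing
    renaming (refl to ≈-refl; sym to ≈-sym; trans to ≈-trans)

  infix 9 _+i_
  record ℂ : Set where
    constructor _+i_
    field
      re im : ℝ

  open ℂ public

  infix 4 _≈ᶜ_
  record _≈ᶜ_ (z w : ℂ) : Set where
    constructor _,_
    field
      re≈ : re z ≈ re w
      im≈ : im z ≈ im w

  open _≈ᶜ_ public

  _+ᶜ_ _*ᶜ_ : ℂ → ℂ → ℂ
  (a +i b) +ᶜ (c +i d) = (a + c) +i (b + d)
  (a +i b) *ᶜ (c +i d) = (a * c - b * d) +i (a * d + b * c)

  -ᶜ_ : ℂ → ℂ
  -ᶜ (a +i b) = (- a) +i (- b)

  ℂ-commutativeRing : CommutativeRing 0ℓ 0ℓ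
  ℂ-commutativeRing = record
    { Carrier = ℂ
    ; _≈_ = _≈ᶜ_
    ; _+_ = _+ᶜ_
    ; _*_ = _*ᶜ_
    ; -_  = -ᶜ_
    ; 0#  = 0# +i 0#
    ; 1#  = 1# +i 0#
    ; isCommutativeRing = record
      { isRing = record
        { +-isAbelianGroup = record
          { isGroup = record
            { isMonoid = record
              { isSemigroup = record
                { isMagma = record
                  { isEquivalence = record
                    { refl  = ≈-refl , ≈-refl
                    ; sym   = λ (p , q) → ≈-sym p , ≈-sym q
                    ; trans = λ (p , q) (p′ , q′) → ≈-trans p p′ , ≈-trans q q′
                    }
                  ; ∙-cong = λ (p , q) (p′ , q′) → +-cong p p′ , +-cong q q′
                  }
                ; assoc = λ (a +i b) (c +i d) (e +i f) → +-assoc a c e , +-assoc b d f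
                }
              ; identity = (λ (a +i b) → +-identityˡ a , +-identityˡ b)
                         , (λ (a +i b) → +-identityʳ a , +-identityʳ b)
              }
            ; inverse = (λ (a +i b) → -‿inverseˡ a , -‿inverseˡ b)
                      , (λ (a +i b) → -‿inverseʳ a , -‿inverseʳ b)
            ; ⁻¹-cong = λ (p , q) → -‿cong p , -‿cong q
            }
          ; comm = λ (a +i b) (c +i d) → +-comm a c , +-comm b d
          }
        ; *-cong = λ (p , q) (p′ , q′) →
            +-cong (*-cong p p′) (-‿cong (*-cong q q′)) , +-cong (*-cong p q′) (*-cong q p′)
        ; *-assoc = λ (a +i b) (c +i d) (e +i f) →
              pointwise (λ n → Laws.assoc-re (seq a n) (seq b n) (seq c n) (seq d n) (seq e n) (seq f n))
            , pointwise (λ n → Laws.assoc-im (seq a n) (seq b n) (seq c n) (seq d n) (seq e n) (seq f n))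
        ; *-identity =
            (λ (a +i b) →
                  pointwise (λ n → Laws.idˡ-re (seq a n) (seq b n))
                , pointwise (λ n → Laws.idˡ-im (seq a n) (seq b n)))
          , (λ (a +i b) →
                  pointwise (λ n → Laws.idʳ-re (seq a n) (seq b n))
                , pointwise (λ n → Laws.idʳ-im (seq a n) (seq b n)))
        ; distrib =
            (λ (a +i b) (c +i d) (e +i f) →
                  pointwise (λ n → Laws.distˡ-re (seq a n) (seq b n) (seq c n) (seq d n) (seq e n) (seq f n))
                , pointwise (λ n → Laws.distˡ-im (seq a n) (seq b n) (seq c n) (seq d n) (seq e n) (seq f n)))
          , (λ (a +i b) (c +i d) (e +i f) →
                  pointwise (λ n → Laws.distʳ-re (seq a n) (seq b n) (seq c n) (seq d n) (seq e n) (seq f n))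
                , pointwise (λ n → Laws.distʳ-im (seq a n) (seq b n) (seq c n) (seq d n) (seq e n) (seq f n)))
        }
      ; *-comm = λ (a +i b) (c +i d) →
            pointwise (λ n → Laws.comm-re (seq a n) (seq b n) (seq c n) (seq d n))
          , pointwise (λ n → Laws.comm-im (seq a n) (seq b n) (seq c n) (seq d n))
      }
    }

open Complex public using (ℂ; ℂ-commutativeRing)

module Matrices {c ℓ} (R : CommutativeRing c ℓ) where

  open CommutativeRing R
  open import Algebra.Properties.CommutativeMonoid.Sum +-commutativeMonoid using (sum)

  Mat : ℕ → Set c
  Mat l = Vector (Vector Carrier l) l

  infix 4 _≋_
  infixl 6 _⊖_
  infixl 7 _·_
  infix 8 ⊝_

  _≋_ : ∀ {l} → Mat l → Mat l → Set ℓ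
  A ≋ B = ∀ i j → A i j ≈ B i j

  O : ∀ {l} → Mat l
  O _ _ = 0#

  I : ∀ {l} → Mat l
  I i j = if does (i ≟ j) then 1# else 0#

  ⊝_ : ∀ {l} → Mat l → Mat l
  (⊝ A) i j = - A i j

  _⊖_ : ∀ {l} → Mat l → Mat l → Mat l
  (A ⊖ B) i j = A i j - B i j

  _·_ : ∀ {l} → Mat l → Mat l → Mat l
  (A · B) i j = sum (λ k → A i k * B k j)

  -- The 2l × 2l matrix with rows of blocks (A B) and (C D).
  block : ∀ {l} → Mat l → Mat l → Mat l → Mat l → Mat (l ℕ.+ l)
  block A B C D = zipWith _++_ A B ++ zipWith _++_ C D

  -- Sequences (aₙ)ₙ≥₁ are functions on ℕ whose value at 0 is never used.

  shift : ∀ {l} → (ℕ → Mat l) → (ℕ → Mat l)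
  shift a n = a (suc n)

  -- 𝔭 (+ m) a only depends on a 1, …, a m, so it is 𝔭ₘ(a₁,…,aₘ), and
  -- 𝔭 (+ r) (shift a) is 𝔭ᵣ(a₂,…,aᵣ₊₁). Indices below -1 are junk.
  𝔭 : ∀ {l} → ℤ → (ℕ → Mat l) → Mat l
  𝔭 -[1+ _ ]          a = O
  𝔭 (+ zero)          a = I
  𝔭 (+ suc zero)      a = a 1 · 𝔭 (+ 0) a ⊖ 𝔭 -[1+ 0 ] a
  𝔭 (+ suc (suc m))   a = a (suc (suc m)) · 𝔭 (+ suc m) a ⊖ 𝔭 (+ m) a

  M : ∀ {l} → ℕ → (ℕ → Mat l) → Mat (l ℕ.+ l)
  M zero    a = I
  M (suc n) a = block (a (suc n)) (⊝ I) I O · M n a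

  Periodic : ∀ {l} → ℕ → (ℕ → Mat l) → Set ℓ
  Periodic N a = ∀ n → 1 ℕ.≤ n → a (n ℕ.+ N) ≋ a n

  IsSolution : ∀ {l} → (a y : ℕ → Mat l) → Set ℓ
  IsSolution a y = ∀ n → 1 ℕ.≤ n → y (n ℕ.+ 1) ≋ a n · y n ⊖ y (n ℕ.∸ 1)

  IsMonodromy : ∀ {l} → ℕ → Mat l → (ℕ → Mat l) → Set ℓ
  IsMonodromy N 𝔪 y = ∀ k → y (k ℕ.+ N) ≋ 𝔪 · y k

  IsMonodromyOfAllSolutions : ∀ {l} → ℕ → (ℕ → Mat l) → Mat l → Set (c Level.⊔ ℓ)
  IsMonodromyOfAllSolutions N a 𝔪 = ∀ y → IsSolution a y → IsMonodromy N 𝔪 y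

open Matrices ℂ-commutativeRing public

{-# OPTIONS --safe #-}

-- A solution is determined by its first two terms: yₙ = uₙ y₁ - wₙ y₀ for the
-- fundamental solutions uₙ = 𝔭ₙ₋₁(a₁,…) and wₙ = 𝔭ₙ₋₂(a₂,…). The four identities
-- say u_N = 𝔪 u₀, u_N₊₁ = 𝔪 u₁, w_N = 𝔪 w₀ and w_N₊₁ = 𝔪 w₁; as 𝔪 commutes with
-- the periodic coefficients, this extends to all solutions and all indices.
-- The blocks of M(a₁,…,a_N) are u_N₊₁, -w_N₊₁, u_N and -w_N.
module Submission where

open import Defs using (module Matrices)
open import Algebra.Bundles using (AbelianGroup; CommutativeRing; Ring)
import Algebra.Construct.Pointwise as Pointwise
import Algebra.Properties.CommutativeSemigroup as CommutativeSemigroupProperties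
import Algebra.Properties.Ring as RingProperties
import Algebra.Properties.Semiring.Sum as SemiringSum
open import Data.Fin.Base using (Fin; zero; suc; splitAt)
open import Data.Nat.Base as ℕ using (ℕ; zero; suc; _≤_; z≤n; s≤s)
open import Data.Nat.Induction using (<-rec)
import Data.Nat.Properties as ℕ
open import Data.Product using (_×_; _,_)
open import Data.Sum.Base as Sum using (_⊎_; inj₁; inj₂)
open import Data.Vec.Functional using (Vector; _++_; zipWith)
open import Function.Base using (_∘_; id)
open import Function.Bundles using (_⇔_; mk⇔)
import Relation.Binary.PropositionalEquality as ≡
import Relation.Binary.Reasoning.Setoid as SetoidReasoning
open import Relation.Nullary.Decidable using (yes; no)

-- Induction along the period.

periodic-induction : ∀ {p} (P : ℕ → Set p) N → 1 ≤ N →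
                     (∀ n → 1 ≤ n → P n → P (n ℕ.+ N)) →
                     (∀ n → 1 ≤ n → n ≤ N → P n) →
                     ∀ n → 1 ≤ n → P n
periodic-induction P N 1≤N step base = <-rec (λ n → 1 ≤ n → P n) λ n rec 1≤n →
  case n rec 1≤n
  where
  case : ∀ n → (∀ {m} → m ℕ.< n → 1 ≤ m → P m) → 1 ≤ n → P n
  case n rec 1≤n with n ℕ.≤? N
  ... | yes n≤N = base n 1≤n n≤N
  -- Descend by a whole period: `n ∸ N` is smaller than `n` because `1 ≤ N`, and still positive
  -- because `N < n`.
  ... | no n≰N = ≡.subst P (ℕ.m∸n+n≡m (ℕ.<⇒≤ N<n))
    (step (n ℕ.∸ N) 0<n∸N (rec (ℕ.∸-monoʳ-< 1≤N (ℕ.<⇒≤ N<n)) 0<n∸N))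
    where
    N<n   = ℕ.≰⇒> n≰N
    0<n∸N = ℕ.m<n⇒0<n∸m N<n

-- Three-term recurrences over a noncommutative ring.

module Recurrence {c ℓ} (R : Ring c ℓ) where

  open Ring R hiding (_-_)
  open Ring R using () renaming (_-_ to _∸_)
  open RingProperties R
  open CommutativeSemigroupProperties
    (AbelianGroup.commutativeSemigroup +-abelianGroup) using (interchange)
  open SetoidReasoning setoid

  -- The index is moved up by one, so the recurrence carries neither a truncated subtraction nor a
  -- side condition and suits two-step induction.
  Solution : (a y : ℕ → Carrier) → Set ℓ
  Solution a y = ∀ n → y (2 ℕ.+ n) ≈ a (suc n) * y (suc n) ∸ y n

  -‿interchange : ∀ w x y z → (w ∸ x) ∸ (y ∸ z) ≈ (w ∸ y) ∸ (x ∸ z)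
  -‿interchange w x y z = begin
    (w + - x) + - (y + - z)    ≈⟨ +-congˡ (-‿+-comm y (- z)) ⟨
    (w + - x) + (- y + - - z)  ≈⟨ interchange w (- x) (- y) (- - z) ⟩
    (w + - y) + (- x + - - z)  ≈⟨ +-congˡ (-‿+-comm x (- z)) ⟩
    (w + - y) + - (x + - z)    ∎

  -‿cong₂ : ∀ {w x y z} → w ≈ x → y ≈ z → w ∸ y ≈ x ∸ z
  -‿cong₂ w≈x y≈z = +-cong w≈x (-‿cong y≈z)

  x≈0∧y≈z⇒y-x≈z : ∀ {x y z} → x ≈ 0# → y ≈ z → y ∸ x ≈ z
  x≈0∧y≈z⇒y-x≈z {x} {y} {z} x≈0 y≈z = begin
    y ∸ x     ≈⟨ -‿cong₂ y≈z x≈0 ⟩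
    z ∸ 0#    ≈⟨ +-congˡ -0#≈0# ⟩
    z + 0#    ≈⟨ +-identityʳ z ⟩
    z         ∎

  module _ {a y u w : ℕ → Carrier}
           (sol-y : Solution a y) (sol-u : Solution a u) (sol-w : Solution a w)
           (u0 : u 0 ≈ 0#) (u1 : u 1 ≈ 1#) (w0 : w 0 ≈ - 1#) (w1 : w 1 ≈ 0#) where

    -- Coefficients act from the left, so right multiples of solutions, and their differences, are
    -- again solutions. Both sides thus obey the same recurrence, and the initial values of `u` and
    -- `w` make them agree at 0 and 1.
    superposition : ∀ n → y n ≈ u n * y 1 ∸ w n * y 0
    superposition zero = sym (begin
      u 0 * y 1 ∸ w 0 * y 0       ≈⟨ -‿cong₂ (*-congʳ u0) (*-congʳ w0) ⟩
      0# * y 1 ∸ - 1# * y 0       ≈⟨ -‿cong₂ (zeroˡ (y 1)) (-1*x≈-x (y 0)) ⟩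
      0# ∸ - y 0                  ≈⟨ +-identityˡ (- - y 0) ⟩
      - - y 0                     ≈⟨ -‿involutive (y 0) ⟩
      y 0                         ∎)
    superposition (suc zero) = sym (x≈0∧y≈z⇒y-x≈z
      (trans (*-congʳ w1) (zeroˡ (y 0))) (trans (*-congʳ u1) (*-identityˡ (y 1))))
    superposition (suc (suc n)) = begin
      y (2 ℕ.+ n)
        ≈⟨ sol-y n ⟩
      α * y (suc n) ∸ y n
        ≈⟨ -‿cong₂ (*-congˡ (superposition (suc n))) (superposition n) ⟩
      α * (u (suc n) * y 1 ∸ w (suc n) * y 0) ∸ (u n * y 1 ∸ w n * y 0)
        ≈⟨ +-congʳ (x[y-z]≈xy-xz α (u (suc n) * y 1) (w (suc n) * y 0)) ⟩
      (α * (u (suc n) * y 1) ∸ α * (w (suc n) * y 0)) ∸ (u n * y 1 ∸ w n * y 0)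
        ≈⟨ +-congʳ (-‿cong₂ (*-assoc α (u (suc n)) (y 1)) (*-assoc α (w (suc n)) (y 0))) ⟨
      (α * u (suc n) * y 1 ∸ α * w (suc n) * y 0) ∸ (u n * y 1 ∸ w n * y 0)
        ≈⟨ -‿interchange _ _ _ _ ⟩
      (α * u (suc n) * y 1 ∸ u n * y 1) ∸ (α * w (suc n) * y 0 ∸ w n * y 0)
        ≈⟨ -‿cong₂ ([y-z]x≈yx-zx (y 1) _ (u n)) ([y-z]x≈yx-zx (y 0) _ (w n)) ⟨
      (α * u (suc n) ∸ u n) * y 1 ∸ (α * w (suc n) ∸ w n) * y 0
        ≈⟨ -‿cong₂ (*-congʳ (sol-u n)) (*-congʳ (sol-w n)) ⟨
      u (2 ℕ.+ n) * y 1 ∸ w (2 ℕ.+ n) * y 0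
        ∎
      where α = a (suc n)

  module _ {a : ℕ → Carrier} {N : ℕ} {m : Carrier}
           (periodic : ∀ n → 1 ≤ n → a (n ℕ.+ N) ≈ a n)
           (commutes : ∀ n → 1 ≤ n → m * a n ≈ a n * m)
           {y : ℕ → Carrier} (sol-y : Solution a y)
           (yN : y N ≈ m * y 0) (y1+N : y (suc N) ≈ m * y 1) where

    -- Periodicity makes the translate by `N` a solution for the same `a`. Left multiplication by
    -- `m` also preserves solutions, since `m` can be moved past each coefficient. Agreement at 0
    -- and 1 then propagates.
    monodromy : ∀ k → y (k ℕ.+ N) ≈ m * y k
    monodromy zero          = yN
    monodromy (suc zero)    = y1+N
    monodromy (suc (suc k)) = begin
      y (2 ℕ.+ k ℕ.+ N)
        ≈⟨ sol-y (k ℕ.+ N) ⟩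
      a (suc k ℕ.+ N) * y (suc k ℕ.+ N) ∸ y (k ℕ.+ N)
        ≈⟨ -‿cong₂ (*-cong (periodic (suc k) (s≤s z≤n)) (monodromy (suc k))) (monodromy k) ⟩
      α * (m * y (suc k)) ∸ m * y k
        ≈⟨ +-congʳ (*-assoc α m (y (suc k))) ⟨
      α * m * y (suc k) ∸ m * y k
        ≈⟨ +-congʳ (*-congʳ (commutes (suc k) (s≤s z≤n))) ⟨
      m * α * y (suc k) ∸ m * y k
        ≈⟨ +-congʳ (*-assoc m α (y (suc k))) ⟩
      m * (α * y (suc k)) ∸ m * y k
        ≈⟨ x[y-z]≈xy-xz m (α * y (suc k)) (y k) ⟨
      m * (α * y (suc k) ∸ y k)
        ≈⟨ *-congˡ (sol-y k) ⟨
      m * y (2 ℕ.+ k)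
        ∎
      where α = a (suc k)

-- The ring of square matrices.

module MatrixProperties {c ℓ} (R : CommutativeRing c ℓ) where

  open Matrices R
  open CommutativeRing R hiding (_-_; zero)
  open RingProperties ring using (-1*x≈-x)
  open SemiringSum semiring
  open SetoidReasoning setoid

  private variable
    l : ℕ

  ·-cong : {A A′ B B′ : Mat l} → A ≋ A′ → B ≋ B′ → A · B ≋ A′ · B′
  ·-cong A≋A′ B≋B′ i j = sum-cong-≋ λ k → *-cong (A≋A′ i k) (B≋B′ k j)

  ·-assoc : (A B C : Mat l) → (A · B) · C ≋ A · (B · C)
  ·-assoc {l} A B C i j = begin
    ∑[ k < l ] (∑[ h < l ] (A i h * B h k) * C k j)
      ≈⟨ sum-cong-≋ (λ k → *-distribʳ-sum (C k j) (λ h → A i h * B h k)) ⟩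
    ∑[ k < l ] ∑[ h < l ] (A i h * B h k * C k j)
      ≈⟨ ∑-comm (λ k h → A i h * B h k * C k j) ⟩
    ∑[ h < l ] ∑[ k < l ] (A i h * B h k * C k j)
      ≈⟨ sum-cong-≋ (λ h → sum-cong-≋ λ k → *-assoc (A i h) (B h k) (C k j)) ⟩
    ∑[ h < l ] ∑[ k < l ] (A i h * (B h k * C k j))
      ≈⟨ sum-cong-≋ (λ h → *-distribˡ-sum (A i h) (λ k → B h k * C k j)) ⟨
    ∑[ h < l ] (A i h * ∑[ k < l ] (B h k * C k j))
      ∎

  sum-zero : ∀ {n} {f : Fin n → Carrier} → (∀ k → f k ≈ 0#) → sum f ≈ 0#
  sum-zero {n} f≈0 = trans (sum-cong-≋ f≈0) (sum-replicate-zero n)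

  -- `I (suc i) (suc k)` computes to `I i k`, so the first term splits off and the rest is the same
  -- sum one size smaller.
  sum-Iˡ : ∀ {n} (i : Fin n) (f : Fin n → Carrier) → ∑[ k < n ] (I i k * f k) ≈ f i
  sum-Iˡ zero f = trans
    (+-cong (*-identityˡ (f zero)) (sum-zero (λ k → zeroˡ (f (suc k)))))
    (+-identityʳ (f zero))
  sum-Iˡ (suc i) f = trans
    (+-cong (zeroˡ (f zero)) (sum-Iˡ i (f ∘ suc)))
    (+-identityˡ (f (suc i)))

  sum-Iʳ : ∀ {n} (j : Fin n) (f : Fin n → Carrier) → ∑[ k < n ] (f k * I k j) ≈ f j
  sum-Iʳ zero f = trans
    (+-cong (*-identityʳ (f zero)) (sum-zero (λ k → zeroʳ (f (suc k)))))
    (+-identityʳ (f zero))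
  sum-Iʳ (suc j) f = trans
    (+-cong (zeroʳ (f zero)) (sum-Iʳ j (f ∘ suc)))
    (+-identityˡ (f (suc j)))

  ·-distribˡ : (A B C : Mat l) → A · (λ i j → B i j + C i j) ≋ (λ i j → (A · B) i j + (A · C) i j)
  ·-distribˡ A B C i j = trans
    (sum-cong-≋ (λ k → distribˡ (A i k) (B k j) (C k j)))
    (∑-distrib-+ (λ k → A i k * B k j) (λ k → A i k * C k j))

  ·-distribʳ : (A B C : Mat l) → (λ i j → B i j + C i j) · A ≋ (λ i j → (B · A) i j + (C · A) i j)
  ·-distribʳ A B C i j = trans
    (sum-cong-≋ (λ k → distribʳ (A k j) (B i k) (C i k)))
    (∑-distrib-+ (λ k → B i k * A k j) (λ k → C i k * A k j))

  Mat-ring : ℕ → Ring c ℓ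
  Mat-ring l = record
    { Carrier = Mat l
    ; _≈_     = _≋_
    ; _+_     = λ A B i j → A i j + B i j
    ; _*_     = _·_
    ; -_      = ⊝_
    ; 0#      = O
    ; 1#      = I
    ; isRing  = record
      { +-isAbelianGroup = Pointwise.isAbelianGroup (Fin l)
          (Pointwise.isAbelianGroup (Fin l) +-isAbelianGroup)
      ; *-cong     = ·-cong
      ; *-assoc    = ·-assoc
      ; *-identity = (λ A i j → sum-Iˡ i (λ k → A k j)) , (λ A i j → sum-Iʳ j (A i))
      ; distrib    = ·-distribˡ , ·-distribʳ
      }
    }

  -- Block matrices.

  block-cong : {A A′ B B′ C C′ D D′ : Mat l} →
               A ≋ A′ → B ≋ B′ → C ≋ C′ → D ≋ D′ →
               block A B C D ≋ block A′ B′ C′ D′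
  block-cong {l} A≋ B≋ C≋ D≋ i j with splitAt l i
  block-cong {l} A≋ B≋ C≋ D≋ i j | inj₁ i′ with splitAt l j
  ... | inj₁ j′ = A≋ i′ j′
  ... | inj₂ j′ = B≋ i′ j′
  block-cong {l} A≋ B≋ C≋ D≋ i j | inj₂ i′ with splitAt l j
  ... | inj₁ j′ = C≋ i′ j′
  ... | inj₂ j′ = D≋ i′ j′

  -- An entry of `xs ++ ys` is by definition a case split on `splitAt`. Taking `f` on the disjoint
  -- union lets this apply directly to the rows and columns of a block matrix.
  sum-splitAt : ∀ m {n} (f : Fin m ⊎ Fin n → Carrier) →
                ∑[ k < m ℕ.+ n ] f (splitAt m k) ≈ sum (f ∘ inj₁) + sum (f ∘ inj₂)
  sum-splitAt zero    f = sym (+-identityˡ (sum (f ∘ inj₂)))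
  sum-splitAt (suc m) f = trans
    (+-congˡ (sum-splitAt m (f ∘ Sum.map suc id)))
    (sym (+-assoc (f (inj₁ zero)) (sum (f ∘ inj₁ ∘ suc)) (sum (f ∘ inj₂))))

  sum-⊝I : ∀ {n} (i : Fin n) (f : Fin n → Carrier) → ∑[ k < n ] ((⊝ I) i k * f k) ≈ - f i
  sum-⊝I {n} i f = begin
    ∑[ k < n ] (- I i k * f k)         ≈⟨ sum-cong-≋ (λ k → neg-entry i k) ⟨
    ∑[ k < n ] (- 1# * (I i k * f k))  ≈⟨ *-distribˡ-sum (- 1#) (λ k → I i k * f k) ⟨
    - 1# * ∑[ k < n ] (I i k * f k)    ≈⟨ *-congˡ (sum-Iˡ i f) ⟩
    - 1# * f i                         ≈⟨ -1*x≈-x (f i) ⟩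
    - f i                              ∎
    where
    neg-entry : ∀ i k → - 1# * (I i k * f k) ≈ - I i k * f k
    neg-entry i k = trans (sym (*-assoc (- 1#) (I i k) (f k))) (*-congʳ (-1*x≈-x (I i k)))

  -- One factor of `M` advances the recurrence by one index in both block columns: the new term
  -- appears on top and the old top row moves down.
  block-step : (A P Q S T : Mat l) →
    block A (⊝ I) I O · block P Q S T ≋ block (A · P ⊖ S) (A · Q ⊖ T) P Q
  block-step {l} A P Q S T i j = row (splitAt l i)
    where
    top bottom : Vector (Vector Carrier (l ℕ.+ l)) l
    top    = zipWith _++_ P Q
    bottom = zipWith _++_ S T

    -- Rows are indexed by the already split index, so that matching on it in `row` reduces the
    -- summands.
    lhs : Fin l ⊎ Fin l → Vector Carrier (l ℕ.+ l)
    lhs = Sum.[ zipWith _++_ A (⊝ I) , zipWith _++_ I O ]′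

    columns : ∀ i′ → ∑[ k < l ] (A i′ k * top k j) + - bottom i′ j ≈
                     ((A · P ⊖ S) i′ ++ (A · Q ⊖ T) i′) j
    columns i′ with splitAt l j
    ... | inj₁ _ = refl
    ... | inj₂ _ = refl

    row : ∀ s → ∑[ k < l ℕ.+ l ] (lhs s k * (top ++ bottom) k j) ≈
                Sum.[ zipWith _++_ (A · P ⊖ S) (A · Q ⊖ T) , top ]′ s j
    row (inj₁ i′) = begin
      ∑[ k < l ℕ.+ l ] ((A i′ ++ (⊝ I) i′) k * (top ++ bottom) k j)
        ≈⟨ sum-splitAt l (λ s → Sum.[ A i′ , (⊝ I) i′ ]′ s * Sum.[ top , bottom ]′ s j) ⟩
      ∑[ k < l ] (A i′ k * top k j) + ∑[ k < l ] ((⊝ I) i′ k * bottom k j)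
        ≈⟨ +-congˡ (sum-⊝I i′ (λ k → bottom k j)) ⟩
      ∑[ k < l ] (A i′ k * top k j) + - bottom i′ j
        ≈⟨ columns i′ ⟩
      ((A · P ⊖ S) i′ ++ (A · Q ⊖ T) i′) j
        ∎
    row (inj₂ i′) = begin
      ∑[ k < l ℕ.+ l ] ((I i′ ++ O i′) k * (top ++ bottom) k j)
        ≈⟨ sum-splitAt l (λ s → Sum.[ I i′ , O i′ ]′ s * Sum.[ top , bottom ]′ s j) ⟩
      ∑[ k < l ] (I i′ k * top k j) + ∑[ k < l ] (0# * bottom k j)
        ≈⟨ +-cong (sum-Iˡ i′ (λ k → top k j)) (sum-zero (λ k → zeroˡ (bottom k j))) ⟩
      top i′ j + 0#
        ≈⟨ +-identityʳ (top i′ j) ⟩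
      top i′ j
        ∎

open import Data.Integer.Base using (+_; _-_)

-- Fundamental solutions and monodromy.

module Monodromy {c ℓ} (R : CommutativeRing c ℓ) {l : ℕ} where

  open Matrices R
  open MatrixProperties R
  open Recurrence (Mat-ring l)
  open Ring (Mat-ring l) using
    ( refl; sym; trans; setoid; zeroˡ; zeroʳ; +-cong; +-congʳ; +-identityˡ
    ; -‿cong; *-congˡ; *-congʳ; *-identityʳ)
  open RingProperties (Mat-ring l) using
    (-0#≈0#; -‿involutive; -‿+-comm; -‿distribˡ-*; -‿distribʳ-*)
  open SetoidReasoning setoid

  -- W a 0 is the recurrence continued backwards from 𝔭₋₁ and 𝔭₀, where 𝔭 has
  -- only a junk value.
  U W : (ℕ → Mat l) → ℕ → Mat l
  U a n       = 𝔭 (+ n - + 1) a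
  W a zero    = ⊝ I
  W a (suc n) = 𝔭 (+ suc n - + 2) (shift a)

  U-solution : ∀ a → Solution a (U a)
  U-solution a zero    = refl
  U-solution a (suc n) = refl

  W-solution : ∀ a → Solution a (W a)
  -- The step that involves the backward value `⊝ I`: it reads `I = a 1 · O - (- I)`.
  W-solution a zero          = sym
    (trans (+-cong (zeroʳ (a 1)) (-‿involutive I)) (+-identityˡ I))
  W-solution a (suc zero)    = refl
  W-solution a (suc (suc n)) = refl

  isSolution⇒solution : ∀ a y → IsSolution a y → Solution a y
  isSolution⇒solution a y sol n =
    ≡.subst (λ k → y k ≋ a (suc n) · y (suc n) ⊖ y n) (ℕ.+-comm (suc n) 1) (sol (suc n) (s≤s z≤n))

  solution⇒isSolution : ∀ a y → Solution a y → IsSolution a y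
  solution⇒isSolution a y sol (suc n) _ =
    ≡.subst (λ k → y k ≋ a (suc n) · y (suc n) ⊖ y n) (ℕ.+-comm 1 (suc n)) (sol n)

  M-blocks : ∀ a n → M (suc n) a ≋
    block (U a (2 ℕ.+ n)) (⊝ W a (2 ℕ.+ n)) (U a (suc n)) (⊝ W a (suc n))
  M-blocks a zero = Mat.trans
    -- Starting from one factor, the unit law absorbs the identity `M 0 a`, which is never written
    -- in blocks.
    (Mat.*-identityʳ (block (a 1) (⊝ I) I O))
    (block-cong (sym (x≈0∧y≈z⇒y-x≈z refl (*-identityʳ (a 1)))) refl refl (sym -0#≈0#))
    where module Mat = Ring (Mat-ring (l ℕ.+ l))
  M-blocks a (suc n) = Mat.trans
    (·-cong (Mat.refl {block (a (2 ℕ.+ n)) (⊝ I) I O}) (M-blocks a n))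
    (Mat.trans
      (block-step (a (2 ℕ.+ n)) (U a (2 ℕ.+ n)) (⊝ W a (2 ℕ.+ n)) (U a (suc n)) (⊝ W a (suc n)))
      (block-cong (sym (U-solution a (suc n))) -W-step refl refl))
    where
    module Mat = Ring (Mat-ring (l ℕ.+ l))
    -W-step : a (2 ℕ.+ n) · (⊝ W a (2 ℕ.+ n)) ⊖ (⊝ W a (suc n)) ≋ ⊝ W a (3 ℕ.+ n)
    -W-step = begin
      a (2 ℕ.+ n) · (⊝ W a (2 ℕ.+ n)) ⊖ (⊝ W a (suc n))
        ≈⟨ +-congʳ (-‿distribʳ-* (a (2 ℕ.+ n)) (W a (2 ℕ.+ n))) ⟨
      (⊝ (a (2 ℕ.+ n) · W a (2 ℕ.+ n))) ⊖ (⊝ W a (suc n))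
        ≈⟨ -‿+-comm (a (2 ℕ.+ n) · W a (2 ℕ.+ n)) (⊝ W a (suc n)) ⟩
      ⊝ (a (2 ℕ.+ n) · W a (2 ℕ.+ n) ⊖ W a (suc n))
        ≈⟨ -‿cong (W-solution a (suc n)) ⟨
      ⊝ W a (3 ℕ.+ n)
        ∎

  -- When `N` is a successor, the left-hand sides compute to `U a N`, `W a N`, `U a (suc N)` and
  -- `W a (suc N)`.
  MonodromyConditions : ℕ → (ℕ → Mat l) → Mat l → Set ℓ
  MonodromyConditions N a 𝔪 =
    𝔭 (+ N - + 1) a ≋ O
    × 𝔭 (+ N - + 2) (shift a) ≋ ⊝ 𝔪
    × 𝔭 (+ N) a ≋ 𝔪
    × 𝔭 (+ N - + 1) (shift a) ≋ O

  -- The hypothesis is tested on `U a` and `W a` at `k = 0` and `k = 1`, where `U a` takes the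
  -- values `O`, `I` and `W a` the values `⊝ I`, `O`.
  monodromy⇒conditions : ∀ n {a 𝔪} → IsMonodromyOfAllSolutions (suc n) a 𝔪 →
                         MonodromyConditions (suc n) a 𝔪
  monodromy⇒conditions n {a} {𝔪} mono =
      trans (U-mono 0) (zeroʳ 𝔪)
    , trans (W-mono 0) (trans (sym (-‿distribʳ-* 𝔪 I)) (-‿cong (*-identityʳ 𝔪)))
    , trans (U-mono 1) (*-identityʳ 𝔪)
    , trans (W-mono 1) (zeroʳ 𝔪)
    where
    U-mono = mono (U a) (solution⇒isSolution a (U a) (U-solution a))
    W-mono = mono (W a) (solution⇒isSolution a (W a) (W-solution a))

  conditions⇒monodromy : ∀ n {a 𝔪} → Periodic (suc n) a →
    (∀ k → 1 ≤ k → k ≤ suc n → 𝔪 · a k ≋ a k · 𝔪) →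
    MonodromyConditions (suc n) a 𝔪 → IsMonodromyOfAllSolutions (suc n) a 𝔪
  conditions⇒monodromy n {a} {𝔪} periodic commutes (uN , wN , u1+N , w1+N) y sol =
    monodromy {a} periodic commutes′ sol′ yN y1+N
    where
    sol′ : Solution a y
    sol′ = isSolution⇒solution a y sol

    y≈ : ∀ k → y k ≋ U a k · y 1 ⊖ W a k · y 0
    y≈ = superposition {a} sol′ (U-solution a) (W-solution a) refl refl refl refl

    commutes′ : ∀ k → 1 ≤ k → 𝔪 · a k ≋ a k · 𝔪
    -- Commutation is given on one period only; since `a (k + N)` equals `a k`, it passes to all
    -- positive indices.
    commutes′ = periodic-induction _ (suc n) (s≤s z≤n)
      (λ k 1≤k comm → trans (*-congˡ (periodic k 1≤k)) (trans comm (sym (*-congʳ (periodic k 1≤k)))))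
      commutes

    yN : y (suc n) ≋ 𝔪 · y 0
    yN = begin
      y (suc n)                                    ≈⟨ y≈ (suc n) ⟩
      U a (suc n) · y 1 ⊖ W a (suc n) · y 0        ≈⟨ -‿cong₂ (*-congʳ uN) (*-congʳ wN) ⟩
      O · y 1 ⊖ (⊝ 𝔪) · y 0                        ≈⟨ -‿cong₂ (zeroˡ (y 1)) (sym (-‿distribˡ-* 𝔪 (y 0))) ⟩
      O ⊖ (⊝ (𝔪 · y 0))                            ≈⟨ +-identityˡ (⊝ (⊝ (𝔪 · y 0))) ⟩
      ⊝ (⊝ (𝔪 · y 0))                              ≈⟨ -‿involutive (𝔪 · y 0) ⟩
      𝔪 · y 0                                      ∎

    y1+N : y (2 ℕ.+ n) ≋ 𝔪 · y 1
    y1+N = trans (y≈ (2 ℕ.+ n))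
      (x≈0∧y≈z⇒y-x≈z (trans (*-congʳ w1+N) (zeroˡ (y 0))) (*-congʳ u1+N))

  conditions⇒M-scalar : ∀ n {a 𝔪} → MonodromyConditions (suc n) a 𝔪 →
                        M (suc n) a ≋ block 𝔪 O O 𝔪
  conditions⇒M-scalar n {a} {𝔪} (uN , wN , u1+N , w1+N) = Ring.trans (Mat-ring (l ℕ.+ l))
    (M-blocks a n)
    (block-cong u1+N (trans (-‿cong w1+N) -0#≈0#) uN (trans (-‿cong wN) (-‿involutive 𝔪)))

-- The result for complex matrices.

open import Defs

proposition48 : ∀ (l N : ℕ) → 1 ≤ N →
    ∀ (a : ℕ → Mat l) → Periodic N a →
    ∀ (𝔪 : Mat l) → (∀ k → 1 ≤ k → k ≤ N → 𝔪 · a k ≋ a k · 𝔪) →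
    (IsMonodromyOfAllSolutions N a 𝔪
    ⇔ (𝔭 (+ N - + 1) a ≋ O
    × 𝔭 (+ N - + 2) (shift a) ≋ ⊝ 𝔪
    × 𝔭 (+ N) a ≋ 𝔪
    × 𝔭 (+ N - + 1) (shift a) ≋ O))
    × (IsMonodromyOfAllSolutions N a 𝔪 → M N a ≋ block 𝔪 O O 𝔪)
-- Writing the period as `suc n` lets the integer indices of `𝔭` compute.
proposition48 l (suc n) _ a periodic 𝔪 commutes =
    mk⇔ (monodromy⇒conditions n) (conditions⇒monodromy n periodic commutes)
  , λ mono → conditions⇒M-scalar n (monodromy⇒conditions n mono)
  where open Monodromy ℂ-commutativeRing
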